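{- Let $t$ be an indeterminate, and let $F_n^{(a)}(q)$ ($n\ge 0$) be the $q$-Fibonacci numbers with parameter $a$. For every integer $n\ge 0$, $$1+\sum_{k=1}^n q^{a+k-1} (tq^{a};q)_{k-1} \left( F^{(a)}_{k-1}(q) - t F^{(a)}_{k+1}(q)\right) =(tq^{a};q)_{n}\, F^{(a)}_{n+1}(q).$$
   Context: The $q$-Fibonacci numbers with parameter $a$ are defined by $F_0^{(a)}(q)=0$, $F_1^{(a)}(q)=1$, and $F_{n+2}^{(a)}(q) = F_{n+1}^{(a)}(q) + q^{a+n} F_n^{(a)}(q)$ for $n\ge 0$. The $q$-rising factorial is $(A;q)_0=1$ and $(A;q)_m=(1-A)(1-Aq)\cdots(1-Aq^{m-1})$ for $m\ge 1$. Here $q$ is a nonzero complex number (or an indeterminate), and $q^{a+m}$ means $q^a\cdot q^m$ for a fixed nonzero value $q^a$. Empty sums equal $0$. -}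

module Defs where

open import Algebra.Bundles using (CommutativeRing)
open import Data.Nat.Base using (ℕ; zero; suc)
import Algebra.Properties.Semiring.Exp as Exp

module _ {c ℓ} (R : CommutativeRing c ℓ) where
  open CommutativeRing R
  open Exp semiring using (_^_)

  -- (A; q)_m = (1 - A)(1 - Aq) ⋯ (1 - Aq^{m-1})
  qRisingFactorial : (A q : Carrier) → ℕ → Carrier
  qRisingFactorial A q zero    = 1#
  qRisingFactorial A q (suc m) = qRisingFactorial A q m * (1# - A * q ^ m)

  -- The parameter a enters only through qᵃ, the fixed value of q^a;
  -- accordingly q^{a+m} is qᵃ * q ^ m.
  qFibonacci : (q qᵃ : Carrier) → ℕ → Carrier
  qFibonacci q qᵃ zero          = 0#
  qFibonacci q qᵃ (suc zero)    = 1#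
  qFibonacci q qᵃ (suc (suc n)) =
    qFibonacci q qᵃ (suc n) + (qᵃ * q ^ n) * qFibonacci q qᵃ n

{-# OPTIONS --safe #-}
module Submission where

open import Defs
open import Algebra.Bundles using (CommutativeRing)
import Algebra.Properties.Ring
import Algebra.Properties.Semiring.Exp
import Algebra.Properties.Semiring.Sum
open import Data.Nat.Base using (ℕ; zero; suc; _∸_)
open import Data.Fin.Base using (toℕ)
import Relation.Binary.Reasoning.Setoid
open import Relation.Nullary using (¬_)

-- The sum telescopes: with Q = q^{a+n}, P = (tq^a;q)_n and F_{n+2} = F_{n+1} + Q F_n,
--   P F_{n+1} + Q P (F_n - t F_{n+2}) = P (1 - t Q) F_{n+2}.

-- Each summand is the increment from `m` to `suc m` of G(m) = (tq^a;q)_m F_{m+1}, and G(0) = 1. In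
-- that increment the recurrence merges F_{m+1} + Q F_m into F_{m+2}; what remains is -tQ F_{m+2},
-- and 1 - tQ is exactly the next factor of the rising factorial.

module _ {c ℓ} (R : CommutativeRing c ℓ) where
  open CommutativeRing R
  open Algebra.Properties.Ring ring using (x[y-z]≈xy-xz; [y-z]x≈yx-zx)
  open Algebra.Properties.Semiring.Sum semiring using (sum-syntax)
  open Relation.Binary.Reasoning.Setoid setoid

  -- The sum unfolds at its index 0 term, which `step 0` absorbs into `g 0`. The induction therefore
  -- continues with both sequences shifted by one, so `f` and `g` must vary with `n`.
  telescope : (f g : ℕ → Carrier) → (∀ m → g m + f m ≈ g (suc m)) →
    ∀ n → g 0 + ∑[ i < n ] f (toℕ i) ≈ g n
  telescope f g step zero    = +-identityʳ (g 0)
  telescope f g step (suc n) = begin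
    g 0 + (f 0 + ∑[ i < n ] f (suc (toℕ i)))  ≈⟨ +-assoc _ _ _ ⟨
    (g 0 + f 0) + ∑[ i < n ] f (suc (toℕ i))  ≈⟨ +-congʳ (step 0) ⟩
    g 1 + ∑[ i < n ] f (suc (toℕ i))
      ≈⟨ telescope (λ m → f (suc m)) (λ m → g (suc m)) (λ m → step (suc m)) n ⟩
    g (suc n)                                 ∎

  -- Here `x` is q^a and `y` is q^m. With `t * x * y` bracketed to the left and `F₂` unfolded, the
  -- right side agrees by computation with the recursive clauses of `qRisingFactorial` and
  -- `qFibonacci`.
  risingFactorial-fibonacci-step : ∀ P x y t F₀ F₁ → let F₂ = F₁ + (x * y) * F₀ in
    P * F₁ + (x * y) * P * (F₀ - t * F₂) ≈ P * (1# - t * x * y) * F₂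
  risingFactorial-fibonacci-step P x y t F₀ F₁ = begin
    P * F₁ + Q * P * (F₀ - t * F₂)    ≈⟨ +-congˡ (*-congʳ (*-comm Q P)) ⟩
    P * F₁ + P * Q * (F₀ - t * F₂)    ≈⟨ +-congˡ (*-assoc P Q _) ⟩
    P * F₁ + P * (Q * (F₀ - t * F₂))  ≈⟨ distribˡ P F₁ _ ⟨
    P * (F₁ + Q * (F₀ - t * F₂))      ≈⟨ *-congˡ factor ⟩
    P * ((1# - t * x * y) * F₂)       ≈⟨ *-assoc P _ F₂ ⟨
    P * (1# - t * x * y) * F₂         ∎
    where
    Q  = x * y
    F₂ = F₁ + Q * F₀

    swap : Q * (t * F₂) ≈ t * x * y * F₂
    swap = begin
      Q * (t * F₂)    ≈⟨ *-assoc Q t F₂ ⟨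
      Q * t * F₂      ≈⟨ *-congʳ (*-comm Q t) ⟩
      t * Q * F₂      ≈⟨ *-congʳ (*-assoc t x y) ⟨
      t * x * y * F₂  ∎

    factor : F₁ + Q * (F₀ - t * F₂) ≈ (1# - t * x * y) * F₂
    factor = begin
      F₁ + Q * (F₀ - t * F₂)           ≈⟨ +-congˡ (x[y-z]≈xy-xz Q F₀ (t * F₂)) ⟩
      F₁ + (Q * F₀ - Q * (t * F₂))     ≈⟨ +-assoc F₁ (Q * F₀) _ ⟨
      -- The recurrence enters here: `F₁ + Q * F₀` is `F₂` by definition.
      F₂ - Q * (t * F₂)                ≈⟨ +-cong (sym (*-identityˡ F₂)) (-‿cong swap) ⟩
      1# * F₂ - t * x * y * F₂         ≈⟨ [y-z]x≈yx-zx F₂ 1# (t * x * y) ⟨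
      (1# - t * x * y) * F₂            ∎

mainTheorem12 : ∀ {c ℓ} (R : CommutativeRing c ℓ) →
  let open CommutativeRing R
      open Algebra.Properties.Semiring.Exp semiring using (_^_)
      open Algebra.Properties.Semiring.Sum semiring using (sum-syntax)
  in (q qᵃ t : Carrier) → ¬ (q ≈ 0#) → ¬ (qᵃ ≈ 0#) →
  let F = qFibonacci R q qᵃ
      ⟨tqᵃ⨾q⟩ = qRisingFactorial R (t * qᵃ) q
  in (n : ℕ) →
  1# + ∑[ i < n ] (let k = suc (toℕ i) in
         (qᵃ * q ^ (k ∸ 1)) * ⟨tqᵃ⨾q⟩ (k ∸ 1) * (F (k ∸ 1) - t * F (suc k)))
    ≈ ⟨tqᵃ⨾q⟩ n * F (suc n)
mainTheorem12 R q qᵃ t _ _ n =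
  -- The leading 1 becomes `P 0 * F 1`, which computes to `1# * 1#`; with `k = suc m`, `k ∸ 1`
  -- computes to `m`.
  trans (+-congʳ (sym (*-identityˡ 1#)))
    (telescope R
      (λ m → (qᵃ * q ^ m) * P m * (F m - t * F (suc (suc m))))
      (λ m → P m * F (suc m))
      (λ m → risingFactorial-fibonacci-step R (P m) qᵃ (q ^ m) t (F m) (F (suc m)))
      n)
  where
  open CommutativeRing R
  open Algebra.Properties.Semiring.Exp semiring using (_^_)
  P = qRisingFactorial R (t * qᵃ) q
  F = qFibonacci R q qᵃ
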